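{- Suppose a countable structure $M$ (in a countable language) admits cross-cutting absolutely indiscernible sets. Then $\mathcal{C}(M)$ is Borel complete.
   Context: A countable structure $M$ admits cross-cutting absolutely indiscernible sets if there are $\mathrm{Aut}(M)$-invariant equivalence relations $E_0,E_1$ on $M$ and families of non-empty subsets $\{D^0_n:n\in\omega\}$, $\{D^1_m:m\in\omega\}$ of $M$, with unions $\mathcal{D}^0_*=\bigcup_nD^0_n$ and $\mathcal{D}^1_*=\bigcup_mD^1_m$, such that: (1) for all $a\in\mathcal{D}^0_*$, $b\in\mathcal{D}^1_*$ there is $c\in M$ with $E_0(c,a)$ and $E_1(c,b)$; (2) for all distinct $n\ne n'$, if $a\in D^0_n$ and $a'\in D^0_{n'}$ then $\neg E_0(a,a')$; and dually for the sets $D^1_m$ and $E_1$; (3) for all $\sigma_0,\sigma_1\in\mathrm{Sym}(\omega)$ there is $\tau\in\mathrm{Aut}(M)$ such that $\tau[D^0_n]=D^0_{\sigma_0(n)}$ and $\tau[D^1_m]=D^1_{\sigma_1(m)}$ for all $n,m\in\omega$. A coloring of $M$ is a function $\mathbf{c}:M\to\omega$; $(M,\mathbf{c})$ denotes the expansion of $M$ by unary predicates $U_n$ ($n\in\omega$) interpreted as $\mathbf{c}^{ -1}(n)$. $\mathcal{C}(M)$ is the class of all $(M,\mathbf{c})$ with $\mathbf{c}$ a coloring of $M$, regarded as the Polish space $\omega^M$ with the isomorphism relation: $(M,\mathbf{c})\cong(M,\mathbf{c}')$ iff there is $\tau\in\mathrm{Aut}(M)$ with $\mathbf{c}'\circ\tau=\mathbf{c}$.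 It is Borel complete if for every countable language $\mathcal{L}'$ and every $\Psi\in\mathcal{L}'_{\omega_1,\omega}$ there is a Borel map $f$ from $\mathrm{Mod}(\Psi)$ (the space of models of $\Psi$ with universe $\omega$) to $\mathcal{C}(M)$ such that $N\cong N'\iff f(N)\cong f(N')$. -}

module Defs where

open import Level using (0ℓ)
open import Data.Bool.Base using (Bool; true)
open import Data.Fin.Base using (Fin)
open import Data.List.Base using (List)
open import Data.List.Relation.Unary.All using (All)
open import Data.Nat.Base using (ℕ)
open import Data.Product.Base using (Σ; _×_; _,_; proj₁; proj₂; ∃; ∃-syntax; Σ-syntax)
open import Data.Sum.Base using (_⊎_; inj₁; inj₂)
open import Data.Vec.Base using (Vec; []; _∷_; lookup; map)
open import Function.Bundles using (_↔_; _↣_; _⇔_; Inverse)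
open import Relation.Binary.Core using (Rel)
open import Relation.Binary.Structures using (IsEquivalence)
open import Relation.Binary.PropositionalEquality using (_≡_; _≢_)
open import Relation.Nullary.Negation using (¬_)
open import Relation.Unary using (Pred; _∈_; _≐_; _⊢_; ∁; ⋃; Satisfiable)

-- At most countable: finite sets are included.
Countable : Set → Set
Countable A = A ↣ ℕ

------------------------------------------------------------------------
-- First-order languages and structures

-- Constants and propositional symbols are the symbols of arity 0.
record Language : Set₁ where
  field
    Fun      : Set
    funArity : Fun → ℕ
    Rels     : Set
    relArity : Rels → ℕ

open Language public

CountableLanguage : Language → Set
CountableLanguage L = Countable (Fun L) × Countable (Rels L)

-- Relations are given by characteristic functions; with excluded middle
-- this is no restriction, and it makes the structures on ℕ literally the
-- points of a product of the discrete spaces ℕ and Bool.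
record Structure (L : Language) (A : Set) : Set where
  field
    fun : (f : Fun L)  → Vec A (funArity L f) → A
    rel : (r : Rels L) → Vec A (relArity L r) → Bool

open Structure public

record Iso {L : Language} {A B : Set}
           (M : Structure L A) (N : Structure L B) : Set where
  field
    bijection : A ↔ B

  ⟦_⟧ : A → B
  ⟦_⟧ = Inverse.to bijection

  field
    pres-fun : ∀ f as → ⟦ fun M f as ⟧ ≡ fun N f (map ⟦_⟧ as)
    pres-rel : ∀ r as → rel M r as ≡ rel N r (map ⟦_⟧ as)

open Iso public using (⟦_⟧)

Aut : ∀ {L A} → Structure L A → Set
Aut M = Iso M M

------------------------------------------------------------------------
-- The infinitary logic L_{ω₁,ω}

data Term (L : Language) (n : ℕ) : Set where
  var : Fin n → Term L n
  app : (f : Fun L) → Vec (Term L n) (funArity L f) → Term L n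

-- Formulas with free variables among n de Bruijn variables.  Conjunctions
-- and disjunctions are indexed by ℕ; finite ones arise by repetition.
data Formula (L : Language) (n : ℕ) : Set where
  equal    : Term L n → Term L n → Formula L n
  relation : (r : Rels L) → Vec (Term L n) (relArity L r) → Formula L n
  neg      : Formula L n → Formula L n
  ⋀ ⋁      : (ℕ → Formula L n) → Formula L n
  all ex   : Formula L (ℕ.suc n) → Formula L n

Sentence : Language → Set
Sentence L = Formula L 0

module _ {L : Language} {A : Set} (M : Structure L A) where

  mutual
    eval : ∀ {n} → Vec A n → Term L n → A
    eval ρ (var i)    = lookup ρ i
    eval ρ (app f ts) = fun M f (evals ρ ts)

    evals : ∀ {n k} → Vec A n → Vec (Term L n) k → Vec A k
    evals ρ []       = []
    evals ρ (t ∷ ts) = eval ρ t ∷ evals ρ ts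

  Sat : ∀ {n} → Vec A n → Formula L n → Set
  Sat ρ (equal s t)     = eval ρ s ≡ eval ρ t
  Sat ρ (relation r ts) = rel M r (evals ρ ts) ≡ true
  Sat ρ (neg φ)         = ¬ Sat ρ φ
  Sat ρ (⋀ φ)           = ∀ i → Sat ρ (φ i)
  Sat ρ (⋁ φ)           = ∃[ i ] Sat ρ (φ i)
  Sat ρ (all φ)         = ∀ a → Sat (a ∷ ρ) φ
  Sat ρ (ex φ)          = ∃[ a ] Sat (a ∷ ρ) φ

_⊨_ : ∀ {L A} → Structure L A → Sentence L → Set
M ⊨ φ = Sat M [] φ

------------------------------------------------------------------------
-- Borel sets and Borel maps

-- A set with the initial topology for a family of maps into discrete
-- spaces, i.e. a subspace of the product of the discrete spaces Value i.
-- Points with the same coordinates are topologically indistinguishable.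
record Space : Set₁ where
  field
    Point : Set
    Index : Set
    Value : Index → Set
    coord : Point → (i : Index) → Value i

open Space public

-- Every point of U has a basic neighbourhood, determined by finitely many
-- coordinates, contained in U.
Open : (X : Space) → Pred (Point X) 0ℓ → Set
Open X U = ∀ {x} → x ∈ U → Σ[ is ∈ List (Index X) ]
  (∀ {y} → All (λ i → coord X y i ≡ coord X x i) is → y ∈ U)

-- The σ-algebra generated by the open sets.  The constructor resp says
-- that being Borel depends only on the extension of a predicate.
data Borel (X : Space) : Pred (Point X) 0ℓ → Set₁ where
  open-set   : ∀ {U} → Open X U → Borel X U
  complement : ∀ {P} → Borel X P → Borel X (∁ P)
  union      : ∀ {P : ℕ → Pred (Point X) 0ℓ} →
               (∀ n → Borel X (P n)) → Borel X (⋃ ℕ P)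
  resp       : ∀ {P Q} → P ≐ Q → Borel X P → Borel X Q

BorelMap : (X Y : Space) → (Point X → Point Y) → Set₁
BorelMap X Y f = ∀ {P} → Borel Y P → Borel X (f ⊢ P)

-- Models of φ with universe ℕ, as a subspace of the product space of all
-- L-structures on ℕ.  The satisfaction proof is not a coordinate, so Borel
-- sets cannot depend on it.
Mod : {L : Language} → Sentence L → Space
Mod {L} φ = record
  { Point = Σ[ N ∈ Structure L ℕ ] N ⊨ φ
  ; Index = (Σ[ f ∈ Fun L ] Vec ℕ (funArity L f)) ⊎
            (Σ[ r ∈ Rels L ] Vec ℕ (relArity L r))
  ; Value = λ { (inj₁ _) → ℕ ; (inj₂ _) → Bool }
  ; coord = λ { (N , _) (inj₁ (f , as)) → fun N f as
              ; (N , _) (inj₂ (r , as)) → rel N r as }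
  }

------------------------------------------------------------------------
-- Colorings

Coloring : Set → Set
Coloring A = A → ℕ

-- The product space ℕ^A.
Colorings : Set → Space
Colorings A = record
  { Point = Coloring A
  ; Index = A
  ; Value = λ _ → ℕ
  ; coord = λ c → c
  }

-- (M , c) ≅ (M , c′), as expansions of M by the predicates U_n = c⁻¹(n).
ColoredIso : ∀ {L A} → Structure L A → Coloring A → Coloring A → Set
ColoredIso M c c′ = Σ[ τ ∈ Aut M ] (∀ a → c′ (⟦ τ ⟧ a) ≡ c a)

-- Borel completeness of the class of colorings of M.
BorelComplete : ∀ {L A} → Structure L A → Set₁
BorelComplete {A = A} M =
  (L′ : Language) → CountableLanguage L′ → (Ψ : Sentence L′) →
  Σ[ f ∈ (Point (Mod Ψ) → Coloring A) ]
    BorelMap (Mod Ψ) (Colorings A) f ×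
    (∀ N N′ → Iso (proj₁ N) (proj₁ N′) ⇔ ColoredIso M (f N) (f N′))

------------------------------------------------------------------------
-- Cross-cutting absolutely indiscernible sets

Image : {A B : Set} → (A → B) → Pred A 0ℓ → Pred B 0ℓ
Image f D b = ∃[ a ] a ∈ D × f a ≡ b

Invariant : ∀ {L A} → Structure L A → Rel A 0ℓ → Set
Invariant M E = ∀ (τ : Aut M) a b → E a b ⇔ E (⟦ τ ⟧ a) (⟦ τ ⟧ b)

record CrossCutting {L : Language} {A : Set} (M : Structure L A) : Set₁ where
  field
    E₀ E₁    : Rel A 0ℓ
    E₀-equiv : IsEquivalence E₀
    E₁-equiv : IsEquivalence E₁
    E₀-inv   : Invariant M E₀
    E₁-inv   : Invariant M E₁
    D⁰ D¹    : ℕ → Pred A 0ℓ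
    D⁰-nonempty : ∀ n → Satisfiable (D⁰ n)
    D¹-nonempty : ∀ m → Satisfiable (D¹ m)

  D⁰∗ : Pred A 0ℓ
  D⁰∗ = ⋃ ℕ D⁰

  D¹∗ : Pred A 0ℓ
  D¹∗ = ⋃ ℕ D¹

  field
    crossing : ∀ {a b} → a ∈ D⁰∗ → b ∈ D¹∗ → ∃[ c ] E₀ c a × E₁ c b
    D⁰-separated : ∀ {n n′} → n ≢ n′ →
                   ∀ {a a′} → a ∈ D⁰ n → a′ ∈ D⁰ n′ → ¬ E₀ a a′
    D¹-separated : ∀ {m m′} → m ≢ m′ →
                   ∀ {b b′} → b ∈ D¹ m → b′ ∈ D¹ m′ → ¬ E₁ b b′
    indiscernible : (σ₀ σ₁ : ℕ ↔ ℕ) → Σ[ τ ∈ Aut M ]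
      (∀ n → Image ⟦ τ ⟧ (D⁰ n) ≐ D⁰ (Inverse.to σ₀ n)) ×
      (∀ m → Image ⟦ τ ⟧ (D¹ m) ≐ D¹ (Inverse.to σ₁ m))

{-# OPTIONS --safe #-}

-- Call the elements E₀-equivalent to a member of D⁰ n and E₁-equivalent to a
-- member of D¹ m the cell (n , m).  The cells are non-empty, disjoint and, by
-- invariance and (3), permuted by Aut(M) through any σ₀ × σ₁, so a colouring
-- constant on cells codes an ℕ × ℕ matrix of colours.  A structure N on ℕ is
-- coded by the matrix with rows (k , s), where k is (the code of) a symbol and
-- s a tuple, and columns j, whose entry records k, the positions of j in s and
-- whether the atomic statement (k , s) holds in N.
--
-- An arbitrary isomorphism of colourings need not preserve the families D⁰
-- and D¹, but it preserves E₀, E₁ and the union of the cells, so it relates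
-- rows to rows and columns to columns, totally and surjectively but possibly
-- in a multivalued way.  Since the row (0 , j ∷ []) separates the column j
-- from all others, the relation between columns is a permutation of ℕ, and
-- the entries show that it is an isomorphism of structures.
module Submission where

open import Level using (0ℓ)
open import Axiom.ExcludedMiddle using (ExcludedMiddle)
open import Defs

open import Data.Bool.Base using (true; if_then_else_)
open import Data.Bool.Properties using (⇔→≡)
open import Data.List.Base as List using (List; []; _∷_)
open import Data.List.Properties as List using (∷-injective; ∷-injectiveˡ; ∷-injectiveʳ)
open import Data.List.Relation.Unary.All using (All; []; _∷_; universal)
open import Data.List.Relation.Unary.All.Properties as All
open import Data.Nat.Base using (ℕ; zero; suc)
open import Data.Nat.Binary.Base using (ℕᵇ; zero; 2[1+_]; 1+[2_]; toℕ; fromℕ)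
open import Data.Nat.Binary.Properties using (toℕ-fromℕ; fromℕ-toℕ)
open import Data.Nat.Properties using (_≟_; suc-injective)
open import Data.Product.Base using (_×_; _,_; proj₁; proj₂; ∃-syntax; uncurry)
open import Data.Product.Properties using (,-injective; ,-injectiveˡ; ,-injectiveʳ)
open import Data.Sum.Base using (_⊎_; inj₁; inj₂)
open import Data.Unit.Base using (⊤; tt)
open import Data.Vec.Base as Vec using (Vec; toList)
open import Data.Vec.Properties as Vec using (toList-map; toList-injective; cast-is-id)
open import Function.Base using (_∘_; id)
open import Function.Bundles using (_↔_; _⇔_; Inverse; Injection; Equivalence; mk↔ₛ′; mk↣; mk⇔)
open import Function.Definitions using (Injective)
open import Function.Properties.Inverse using (↔-sym; ↔-trans; ↔⇒↣)
open import Relation.Binary.PropositionalEquality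
  using (_≡_; refl; sym; trans; cong; cong₂; subst; module ≡-Reasoning)
open import Relation.Binary.Structures using (IsEquivalence)
open import Relation.Nullary.Decidable using (Dec; yes; no; does; does-⇔; decidable-stable)
open import Relation.Nullary.Negation using (¬_; contradiction)
open import Relation.Unary using (Pred; _∈_; _≐_; _∪_; _∩_; ∁; ⋃)

private
  variable
    I A B : Set

to-injective : (e : A ↔ B) → Injective _≡_ _≡_ (Inverse.to e)
to-injective e = Injection.injective (↔⇒↣ e)

-- Coding

bit : Dec A → ℕ
bit d = if does d then 1 else 0

bit-cong : A ⇔ B → (a? : Dec A) (b? : Dec B) → bit a? ≡ bit b?
bit-cong A⇔B a? b? = cong (if_then 1 else 0) (does-⇔ A⇔B a? b?)

bit-transfer : (a? : Dec A) (b? : Dec B) → bit a? ≡ bit b? → A → B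
bit-transfer a?      (yes b) _  _ = b
bit-transfer (no ¬a) (no _)  _  a = contradiction a ¬a
bit-transfer (yes _) (no _)  () _

-- In the digits 2 and 1 of bijective numeration, n ∷ s is written with the
-- entries in unary (digit 2) and the digit 1 as separator.
toWord : ℕ → List ℕ → ℕᵇ
toWord zero    []      = zero
toWord zero    (m ∷ s) = 1+[2 toWord m s ]
toWord (suc n) s       = 2[1+ toWord n s ]

fromWord : ℕᵇ → ℕ × List ℕ
fromWord zero     = 0 , []
fromWord 2[1+ w ] = suc (proj₁ (fromWord w)) , proj₂ (fromWord w)
fromWord 1+[2 w ] = 0 , proj₁ (fromWord w) ∷ proj₂ (fromWord w)

toWord-fromWord : ∀ w → uncurry toWord (fromWord w) ≡ w
toWord-fromWord zero     = refl
toWord-fromWord 2[1+ w ] = cong 2[1+_] (toWord-fromWord w)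
toWord-fromWord 1+[2 w ] = cong 1+[2_] (toWord-fromWord w)

fromWord-toWord : ∀ n s → fromWord (toWord n s) ≡ (n , s)
fromWord-toWord zero    []      = refl
fromWord-toWord zero    (m ∷ s) rewrite fromWord-toWord m s = refl
fromWord-toWord (suc n) s       rewrite fromWord-toWord n s = refl

Row : Set
Row = ℕ × List ℕ

-- Abstract so that equations between codes are solved by comparing arguments.
abstract
  Row↔ℕ : Row ↔ ℕ
  Row↔ℕ = mk↔ₛ′ (toℕ ∘ uncurry toWord) (fromWord ∘ fromℕ)
    (λ n → trans (cong toℕ (toWord-fromWord (fromℕ n))) (toℕ-fromℕ n))
    (λ { (n , s) → trans (cong fromWord (fromℕ-toℕ (toWord n s))) (fromWord-toWord n s) })

encode : Row → ℕ
encode = Inverse.to Row↔ℕ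

encode-injective : Injective _≡_ _≡_ encode
encode-injective = to-injective Row↔ℕ

×-countable : Countable A → Countable B → Countable (A × B)
×-countable i j = mk↣ {to = λ (a , b) → encode (Injection.to i a , Injection.to j b ∷ [])}
  λ eq → let p , q = ,-injective (encode-injective eq) in
    cong₂ _,_ (Injection.injective i p) (Injection.injective j (∷-injectiveˡ q))

⊎-countable : Countable A → Countable B → Countable (A ⊎ B)
⊎-countable {A} {B} i j = mk↣ {to = code} code-injective
  where
  code : A ⊎ B → ℕ
  code (inj₁ a) = encode (0 , Injection.to i a ∷ [])
  code (inj₂ b) = encode (1 , Injection.to j b ∷ [])

  code-injective : Injective _≡_ _≡_ code
  code-injective {inj₁ _} {inj₁ _} eq =
    cong inj₁ (Injection.injective i (∷-injectiveˡ (,-injectiveʳ (encode-injective eq))))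
  code-injective {inj₂ _} {inj₂ _} eq =
    cong inj₂ (Injection.injective j (∷-injectiveˡ (,-injectiveʳ (encode-injective eq))))
  code-injective {inj₁ _} {inj₂ _} eq with () ← ,-injectiveˡ (encode-injective eq)
  code-injective {inj₂ _} {inj₁ _} eq with () ← ,-injectiveˡ (encode-injective eq)

List-countable : Countable A → Countable (List A)
List-countable i = mk↣ {to = λ as → encode (0 , List.map (Injection.to i) as)}
  λ eq → List.map-injective (Injection.injective i) (,-injectiveʳ (encode-injective eq))

mapRow : (ℕ → ℕ) → Row → Row
mapRow π (k , s) = k , List.map π s

mapRow-inverse : ∀ {f g : ℕ → ℕ} → (∀ n → f (g n) ≡ n) → ∀ t → mapRow f (mapRow g t) ≡ t
mapRow-inverse inv (k , s) =
  cong (k ,_) (trans (sym (List.map-∘ s)) (trans (List.map-cong inv s) (List.map-id s)))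

Row-perm : ℕ ↔ ℕ → Row ↔ Row
Row-perm π = mk↔ₛ′ (mapRow (Inverse.to π)) (mapRow (Inverse.from π))
  (mapRow-inverse (Inverse.strictlyInverseˡ π)) (mapRow-inverse (Inverse.strictlyInverseʳ π))

-- The positions of j in s, as a list of marks. Renaming j and s by the same injection leaves the
-- marks unchanged, so a colour may record them where it could not record s itself.
occurrences : ℕ → List ℕ → List ℕ
occurrences j = List.map (λ x → bit (x ≟ j))

occurrences-map : ∀ {π} → Injective _≡_ _≡_ π →
                  ∀ j s → occurrences (π j) (List.map π s) ≡ occurrences j s
occurrences-map {π} inj j s = trans (sym (List.map-∘ s))
  (List.map-cong (λ x → bit-cong (mk⇔ inj (cong π)) (π x ≟ π j) (x ≟ j)) s)

-- There is one mark per entry, so the lengths agree. In the column of the head x the first mark is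
-- 1, which forces the head of `s′` to be `π x`.
occurrences-determine : ∀ (π : ℕ → ℕ) s s′ →
  (∀ j → occurrences j s ≡ occurrences (π j) s′) → s′ ≡ List.map π s
occurrences-determine π []      []       _  = refl
occurrences-determine π []      (_ ∷ _)  eq with () ← eq 0
occurrences-determine π (_ ∷ _) []       eq with () ← eq 0
occurrences-determine π (x ∷ s) (y ∷ s′) eq = cong₂ _∷_
  (bit-transfer (x ≟ x) (y ≟ π x) (∷-injectiveˡ (eq x)) refl)
  (occurrences-determine π s s′ (∷-injectiveʳ ∘ eq))

-- Borel sets


module _ (em : ExcludedMiddle 0ℓ) {X : Space} where

  private
    variable
      P Q : Pred (Point X) 0ℓ

  -- The union is reindexed by ℕ: the set at n is `P i` when n is the code of i, and empty when n is
  -- no code.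
  ⋃-Borel : Countable I → {P : I → Pred (Point X) 0ℓ} →
            (∀ i → Borel X (P i)) → Borel X (⋃ I P)
  ⋃-Borel {I} e {P} P-Borel =
    resp ((λ { (_ , i , _ , p) → i , p }) , (λ { (i , p) → Injection.to e i , i , refl , p }))
      (union fibre-Borel)
    where
    fibre-Borel : ∀ n → Borel X (λ x → ∃[ i ] Injection.to e i ≡ n × P i x)
    fibre-Borel n with em {∃[ i ] Injection.to e i ≡ n}
    ... | yes (i , eq) = resp ((λ p → i , eq , p) , λ { (j , eq′ , p) →
            subst (λ k → P k _) (Injection.injective e (trans eq′ (sym eq))) p }) (P-Borel i)
    ... | no ¬i        = open-set λ { (i , eq , _) → contradiction (i , eq) ¬i }

  ∪-Borel : Borel X P → Borel X Q → Borel X (P ∪ Q)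
  ∪-Borel {P} {Q} p q =
    resp ((λ { (zero , x) → inj₁ x ; (suc _ , x) → inj₂ x })
         , (λ { (inj₁ x) → 0 , x ; (inj₂ x) → 1 , x }))
      (union {P = λ { zero → P ; (suc _) → Q }} λ { zero → p ; (suc _) → q })

  ∩-Borel : Borel X P → Borel X Q → Borel X (P ∩ Q)
  ∩-Borel {P} {Q} p q = resp (classical , λ { (x , y) (inj₁ ¬x) → ¬x x ; (x , y) (inj₂ ¬y) → ¬y y })
    (complement (∪-Borel (complement p) (complement q)))
    where
    classical : ∀ {x} → x ∈ ∁ (∁ P ∪ ∁ Q) → x ∈ P ∩ Q
    classical {x} h with em {P x} | em {Q x}
    ... | yes a | yes b = a , b
    ... | no ¬a | _     = contradiction (inj₁ ¬a) h
    ... | yes _ | no ¬b = contradiction (inj₂ ¬b) h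

  -- Admits side conditions independent of the point: the neighbourhood inspects no coordinate.
  const-Borel : (R : Set) → Borel X (λ _ → R)
  const-Borel R = open-set (λ r → [] , λ _ → r)

  bit-Borel : Borel X P → (R : Pred ℕ 0ℓ) → Borel X (λ x → R (bit (em {P x})))
  bit-Borel {P} p R = resp (to , from)
    (∪-Borel (∩-Borel p (const-Borel (R 1))) (∩-Borel (complement p) (const-Borel (R 0))))
    where
    to : ∀ {x} → x ∈ (P ∩ (λ _ → R 1)) ∪ (∁ P ∩ (λ _ → R 0)) → R (bit (em {P x}))
    to {x} h with em {P x} | h
    ... | yes _ | inj₁ (_ , r)  = r
    ... | yes a | inj₂ (¬a , _) = contradiction a ¬a
    ... | no ¬a | inj₁ (a , _)  = contradiction a ¬a
    ... | no _  | inj₂ (_ , r)  = r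

    from : ∀ {x} → R (bit (em {P x})) → x ∈ (P ∩ (λ _ → R 1)) ∪ (∁ P ∩ (λ _ → R 0))
    from {x} r with em {P x}
    ... | yes a = inj₁ (a , r)
    ... | no ¬a = inj₂ (¬a , r)

  -- An open subset of ℕ^A is the union of the basic open sets it contains,
  -- and there are countably many of those.
  coordinatewise-Borel : Countable A → (f : Point X → Coloring A) →
    (∀ a v → Borel X (λ x → f x a ≡ v)) → BorelMap X (Colorings A) f
  coordinatewise-Borel {A} A-countable f f-Borel = preimage
    where
    Agrees : Coloring A → List (A × ℕ) → Set
    Agrees c = All (λ (a , v) → c a ≡ v)

    Agrees-Borel : ∀ l → Borel X (λ x → Agrees (f x) l)
    Agrees-Borel []            = resp ((λ _ → []) , λ _ → tt) (const-Borel ⊤)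
    Agrees-Borel ((a , v) ∷ l) =
      resp ((λ (p , ps) → p ∷ ps) , λ { (p ∷ ps) → p , ps })
        (∩-Borel (f-Borel a v) (Agrees-Borel l))

    preimage : BorelMap X (Colorings A) f
    preimage (open-set {U} U-open) =
      resp ((λ (_ , agrees , ⊆U) → ⊆U _ agrees) , λ {x} fx∈U →
             let is , nbhd = U-open fx∈U in
             List.map (λ a → a , f x a) is
             , All.map⁺ (universal (λ _ → refl) is)
             , λ _ agrees → nbhd (All.map⁻ agrees))
        (⋃-Borel (List-countable (×-countable A-countable (mk↣ id)))
          λ l → ∩-Borel (Agrees-Borel l) (const-Borel (∀ c → Agrees c l → c ∈ U)))
    preimage (complement p)           = complement (preimage p)
    preimage (union p)                = union (λ n → preimage (p n))
    preimage (resp (P⊆Q , Q⊆P) p)     = resp (P⊆Q , Q⊆P) (preimage p)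

-- Isomorphisms

module _ {L : Language} where

  Iso-sym : {M : Structure L A} {N : Structure L B} → Iso M N → Iso N M
  Iso-sym {M = M} {N} φ = record
    { bijection = ↔-sym (Iso.bijection φ)
    ; pres-fun  = λ f bs → begin
        ψ (fun N f bs)                             ≡⟨ cong (ψ ∘ fun N f) (φψ* bs) ⟨
        ψ (fun N f (Vec.map ⟦ φ ⟧ (Vec.map ψ bs))) ≡⟨ cong ψ (Iso.pres-fun φ f (Vec.map ψ bs)) ⟨
        ψ (⟦ φ ⟧ (fun M f (Vec.map ψ bs)))         ≡⟨ strictlyInverseʳ _ ⟩
        fun M f (Vec.map ψ bs)                     ∎
    ; pres-rel  = λ r bs → trans (cong (rel N r) (sym (φψ* bs))) (sym (Iso.pres-rel φ r (Vec.map ψ bs)))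
    }
    where
    open ≡-Reasoning
    open Inverse (Iso.bijection φ) using (strictlyInverseˡ; strictlyInverseʳ) renaming (from to ψ)

    φψ* : ∀ {n} (bs : Vec _ n) → Vec.map ⟦ φ ⟧ (Vec.map ψ bs) ≡ bs
    φψ* bs = trans (sym (Vec.map-∘ ⟦ φ ⟧ ψ bs)) (trans (Vec.map-cong strictlyInverseˡ bs) (Vec.map-id bs))

-- The matrix of a structure

module Matrix (em : ExcludedMiddle 0ℓ) {L : Language} (L-countable : CountableLanguage L) where

  symbol-countable : Countable (Fun L ⊎ Rels L)
  symbol-countable = ⊎-countable (proj₁ L-countable) (proj₂ L-countable)

  symbol : Fun L ⊎ Rels L → ℕ
  symbol = Injection.to symbol-countable

  symbol-injective : Injective _≡_ _≡_ symbol
  symbol-injective = Injection.injective symbol-countable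

  -- A function symbol is read as the relation "value ∷ arguments".
  data Holds (N : Structure L ℕ) : Row → Set where
    fun-holds : ∀ f as → Holds N (symbol (inj₁ f) , fun N f as ∷ toList as)
    rel-holds : ∀ r as → rel N r as ≡ true → Holds N (symbol (inj₂ r) , toList as)

  toList-cancel : ∀ {n} {as bs : Vec ℕ n} → toList as ≡ toList bs → as ≡ bs
  toList-cancel {as = as} {bs} eq = trans (sym (cast-is-id refl as)) (toList-injective refl as bs eq)

  -- The row is generalised to an arbitrary t with an equation, because `symbol` is an opaque
  -- injection; its injectivity then recovers the symbol, and with it the arguments.
  fun-holds⁻¹ : ∀ {N} f y as → Holds N (symbol (inj₁ f) , y ∷ toList as) → fun N f as ≡ y
  fun-holds⁻¹ {N} f y as h = invert h refl
    where
    invert : ∀ {t} → Holds N t → t ≡ (symbol (inj₁ f) , y ∷ toList as) → fun N f as ≡ y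
    invert (fun-holds g bs) eq with symbol-injective {inj₁ g} {inj₁ f} (,-injectiveˡ eq)
    ... | refl with ∷-injective (,-injectiveʳ eq)
    ...   | val , args = trans (cong (fun N f) (sym (toList-cancel args))) val
    invert (rel-holds r bs _) eq with () ← symbol-injective {inj₂ r} {inj₁ f} (,-injectiveˡ eq)

  rel-holds⁻¹ : ∀ {N} r as → Holds N (symbol (inj₂ r) , toList as) → rel N r as ≡ true
  rel-holds⁻¹ {N} r as h = invert h refl
    where
    invert : ∀ {t} → Holds N t → t ≡ (symbol (inj₂ r) , toList as) → rel N r as ≡ true
    invert (fun-holds g bs) eq with () ← symbol-injective {inj₁ g} {inj₂ r} (,-injectiveˡ eq)
    invert (rel-holds q bs holds) eq with symbol-injective {inj₂ q} {inj₂ r} (,-injectiveˡ eq)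
    ... | refl = trans (cong (rel N r) (sym (toList-cancel (,-injectiveʳ eq)))) holds

  Holds-Iso : ∀ {N N′} (φ : Iso N N′) {t} → Holds N t → Holds N′ (mapRow ⟦ φ ⟧ t)
  Holds-Iso {N} {N′} φ (fun-holds f as) =
    subst (λ s → Holds N′ (symbol (inj₁ f) , s))
      (cong₂ _∷_ (sym (Iso.pres-fun φ f as)) (toList-map ⟦ φ ⟧ as))
      (fun-holds f (Vec.map ⟦ φ ⟧ as))
  Holds-Iso {N} {N′} φ (rel-holds r as holds) =
    subst (λ s → Holds N′ (symbol (inj₂ r) , s)) (toList-map ⟦ φ ⟧ as)
      (rel-holds r (Vec.map ⟦ φ ⟧ as) (trans (sym (Iso.pres-rel φ r as)) holds))

  Holds-Iso⇔ : ∀ {N N′} (φ : Iso N N′) t → Holds N′ (mapRow ⟦ φ ⟧ t) ⇔ Holds N t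
  Holds-Iso⇔ {N} φ t = mk⇔
    (λ h → subst (Holds N) (Inverse.strictlyInverseʳ (Row-perm (Iso.bijection φ)) t)
             (Holds-Iso (Iso-sym φ) h))
    (Holds-Iso φ)

  -- For a function symbol, the image of the row "value ∷ arguments" of N holds in `N′`, which fixes
  -- the value there. For a relation symbol the two implications make the truth values equal.
  Holds⇔⇒Iso : ∀ {N N′} (π : ℕ ↔ ℕ) →
    (∀ t → Holds N t ⇔ Holds N′ (mapRow (Inverse.to π) t)) → Iso N N′
  Holds⇔⇒Iso {N} {N′} π equiv = record
    { bijection = π
    ; pres-fun  = λ f as → sym (fun-holds⁻¹ f _ _
        (subst (λ s → Holds N′ (_ , _ ∷ s)) (sym (toList-map p as))
          (Equivalence.to (equiv _) (fun-holds f as))))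
    ; pres-rel  = λ r as → ⇔→≡ {z = true} (mk⇔
        (λ h → rel-holds⁻¹ r _
          (subst (λ s → Holds N′ (_ , s)) (sym (toList-map p as))
            (Equivalence.to (equiv _) (rel-holds r as h))))
        (λ h → rel-holds⁻¹ r as (Equivalence.from (equiv _)
          (subst (λ s → Holds N′ (_ , s)) (toList-map p as)
            (rel-holds r (Vec.map p as) h)))))
    }
    where p = Inverse.to π

  entry : Structure L ℕ → Row → ℕ → ℕ
  entry N (k , s) j = encode (k , bit (em {Holds N (k , s)}) ∷ occurrences j s)

  entry-Iso : ∀ {N N′} (φ : Iso N N′) t j → entry N′ (mapRow ⟦ φ ⟧ t) (⟦ φ ⟧ j) ≡ entry N t j
  entry-Iso φ (k , s) j = cong (λ l → encode (k , l)) (cong₂ _∷_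
    (bit-cong (Holds-Iso⇔ φ (k , s)) em em)
    (occurrences-map (to-injective (Iso.bijection φ)) j s))

  entry-injective : ∀ {N N′} k s j k′ s′ j′ → entry N (k , s) j ≡ entry N′ (k′ , s′) j′ →
    k ≡ k′ × bit (em {Holds N (k , s)}) ≡ bit (em {Holds N′ (k′ , s′)}) ×
    occurrences j s ≡ occurrences j′ s′
  entry-injective k s j k′ s′ j′ eq =
    let k≡k′ , l≡l′ = ,-injective (encode-injective eq) in k≡k′ , ∷-injective l≡l′

  -- The tuple `j ∷ []` is marked 1 in the column j alone. The number 0 need not code a symbol, as
  -- only the marks are compared.
  entry-separates : ∀ {N j j′} → entry N (0 , j ∷ []) j ≡ entry N (0 , j ∷ []) j′ → j ≡ j′
  entry-separates {N} {j} {j′} eq =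
    let _ , _ , occ = entry-injective {N} {N} 0 (j ∷ []) j 0 (j ∷ []) j′ eq in
    bit-transfer (j ≟ j) (j ≟ j′) (∷-injectiveˡ occ) refl

  module _ {N N′ : Structure L ℕ} (_~ᵣ_ : Row → Row → Set) (_~ᶜ_ : ℕ → ℕ → Set)
    (entries : ∀ {t t′ j j′} → t ~ᵣ t′ → j ~ᶜ j′ → entry N′ t′ j′ ≡ entry N t j)
    (rowˡ : ∀ t → ∃[ t′ ] t ~ᵣ t′) (rowʳ : ∀ t′ → ∃[ t ] t ~ᵣ t′)
    (colˡ : ∀ j → ∃[ j′ ] j ~ᶜ j′) (colʳ : ∀ j′ → ∃[ j ] j ~ᶜ j′)
    where

    private
      functional : ∀ {j j′ j″} → j ~ᶜ j′ → j ~ᶜ j″ → j′ ≡ j″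
      -- The row `(0 , j′ ∷ [])` of `N′` has a partner in N, whose entry at j equals the entries of
      -- this row at both `j′` and `j″`.
      functional p q = let _ , r = rowʳ _ in
        entry-separates {N′} (trans (entries r p) (sym (entries r q)))

      injective : ∀ {j i j′} → j ~ᶜ j′ → i ~ᶜ j′ → j ≡ i
      injective p q = let _ , r = rowˡ _ in
        entry-separates {N} (trans (sym (entries r p)) (entries r q))

      π : ℕ → ℕ
      π = proj₁ ∘ colˡ

      π↔ : ℕ ↔ ℕ
      π↔ = mk↔ₛ′ π (proj₁ ∘ colʳ)
        (λ j′ → functional (proj₂ (colˡ _)) (proj₂ (colʳ j′)))
        (λ j → injective (proj₂ (colʳ _)) (proj₂ (colˡ j)))

    matching⇒Iso : Iso N N′
    matching⇒Iso = Holds⇔⇒Iso π↔ equiv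
      where
      equiv : ∀ t → Holds N t ⇔ Holds N′ (mapRow π t)
      equiv (k , s) with rowˡ (k , s)
      ... | (k′ , s′) , r = subst (λ t → Holds N (k , s) ⇔ Holds N′ t) row-eq
              (mk⇔ (bit-transfer em em bits) (bit-transfer em em (sym bits)))
        where
        parts = λ j → entry-injective {N} {N′} k s j k′ s′ (π j) (sym (entries r (proj₂ (colˡ j))))
        -- The symbol and the truth value do not depend on the column, so column 0 is an arbitrary
        -- choice; the tuple is recovered from all columns together.
        bits = proj₁ (proj₂ (parts 0))
        row-eq : (k′ , s′) ≡ mapRow π (k , s)
        row-eq = cong₂ _,_ (sym (proj₁ (parts 0)))
          (occurrences-determine π s s′ (λ j → proj₂ (proj₂ (parts j))))

-- Cells and colourings

module Coding (em : ExcludedMiddle 0ℓ) {L : Language} {M : Structure L A} (X : CrossCutting M)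
  {L′ : Language} (L′-countable : CountableLanguage L′) where

  open CrossCutting X
  open Matrix em {L′} L′-countable
  private
    module E₀ = IsEquivalence E₀-equiv
    module E₁ = IsEquivalence E₁-equiv

  Cell : A → Row → ℕ → Set
  Cell c t j = (∃[ a ] a ∈ D⁰ (encode t) × E₀ c a) × (∃[ b ] b ∈ D¹ j × E₁ c b)

  InCell : A → Set
  InCell c = ∃[ t ] ∃[ j ] Cell c t j

  -- Representatives equivalent to the same c are equivalent to each other, which separation forbids
  -- for distinct indices.
  Cell-unique : ∀ {c t t′ j j′} → Cell c t j → Cell c t′ j′ → t ≡ t′ × j ≡ j′
  Cell-unique {t = t} {t′} {j} {j′}
    ((a , a∈ , ca) , (b , b∈ , cb)) ((a′ , a′∈ , ca′) , (b′ , b′∈ , cb′)) =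
    encode-injective (decidable-stable (encode t ≟ encode t′)
      (λ t≢t′ → D⁰-separated t≢t′ a∈ a′∈ (E₀.trans (E₀.sym ca) ca′)))
    , decidable-stable (j ≟ j′) (λ j≢j′ → D¹-separated j≢j′ b∈ b′∈ (E₁.trans (E₁.sym cb) cb′))

  -- Colour 0 is reserved for elements outside all cells, so that colours reveal the union of the
  -- cells. The choice of cell is harmless, since an element lies in at most one.
  colour : Structure L′ ℕ → Coloring A
  colour N c with em {InCell c}
  ... | yes (t , j , _) = suc (entry N t j)
  ... | no _            = 0

  colour-Cell : ∀ N {c t j} → Cell c t j → colour N c ≡ suc (entry N t j)
  colour-Cell N {c} {t} {j} cell with em {InCell c}
  ... | yes (t′ , j′ , cell′) =
          let t′≡t , j′≡j = Cell-unique {c} {t′} {t} {j′} {j} cell′ cell in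
          cong suc (cong₂ (entry N) t′≡t j′≡j)
  ... | no ¬cell = contradiction (_ , _ , cell) ¬cell

  colour-¬InCell : ∀ N {c} → ¬ InCell c → colour N c ≡ 0
  colour-¬InCell N {c} ¬cell with em {InCell c}
  ... | yes cell = contradiction cell ¬cell
  ... | no _     = refl

  colour-suc⇒InCell : ∀ N {c v} → colour N c ≡ suc v → InCell c
  colour-suc⇒InCell N {c} eq with em {InCell c}
  ... | yes cell = cell
  colour-suc⇒InCell N {c} () | no _

  -- Borel measurability of the coding

  Holds-Borel : ∀ Ψ t → Borel (Mod Ψ) (λ N → Holds (proj₁ N) t)
  Holds-Borel Ψ t = open-set witness
    where
    witness : Open (Mod Ψ) (λ N → Holds (proj₁ N) t)
    -- A single coordinate witnesses an atomic statement.
    witness (fun-holds f as) = inj₁ (f , as) ∷ [] , λ { {N , _} (eq ∷ []) →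
      subst (λ y → Holds N (symbol (inj₁ f) , y ∷ toList as)) eq (fun-holds f as) }
    witness (rel-holds r as holds) = inj₂ (r , as) ∷ [] , λ { (eq ∷ []) →
      rel-holds r as (trans eq holds) }

  colour-Borel : Countable A → ∀ Ψ → BorelMap (Mod Ψ) (Colorings A) (colour ∘ proj₁)
  colour-Borel A-countable Ψ = coordinatewise-Borel em A-countable _ value-Borel
    where
    value-Borel : ∀ c v → Borel (Mod Ψ) (λ N → colour (proj₁ N) c ≡ v)
    -- The cell of c depends on M alone; N enters the colour only through the truth bit.
    value-Borel c v with em {InCell c}
    ... | yes ((k , s) , j , _) = bit-Borel em (Holds-Borel Ψ (k , s))
            (λ b → suc (encode (k , b ∷ occurrences j s)) ≡ v)
    ... | no _                  = const-Borel em (0 ≡ v)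

  -- From isomorphisms of structures to isomorphisms of colourings

  cell-perm⇒ColoredIso : ∀ {N N′} (τ : Aut M) (ρ : Row ↔ Row) (σ : ℕ ↔ ℕ) →
    (∀ {c t j} → Cell c t j → Cell (⟦ τ ⟧ c) (Inverse.to ρ t) (Inverse.to σ j)) →
    (∀ {c t j} → Cell (⟦ τ ⟧ c) (Inverse.to ρ t) (Inverse.to σ j) → Cell c t j) →
    (∀ t j → entry N′ (Inverse.to ρ t) (Inverse.to σ j) ≡ entry N t j) →
    ColoredIso M (colour N) (colour N′)
  cell-perm⇒ColoredIso {N} {N′} τ ρ σ to from eq = τ , preserves
    where
    preserves : ∀ c → colour N′ (⟦ τ ⟧ c) ≡ colour N c
    preserves c with em {InCell c}
    ... | yes (t , j , cell) = trans (colour-Cell N′ (to cell)) (cong suc (eq t j))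
    -- An element outside the cells must stay outside to keep colour 0: a cell of its image would
    -- pull back along `from`.
    ... | no ¬cell = colour-¬InCell N′ λ (t′ , j′ , cell′) →
            ¬cell (_ , _ , from (relabel t′ j′ cell′))
      where
      relabel : ∀ t′ j′ → Cell (⟦ τ ⟧ c) t′ j′ →
        Cell (⟦ τ ⟧ c) (Inverse.to ρ (Inverse.from ρ t′)) (Inverse.to σ (Inverse.from σ j′))
      relabel t′ j′ cell
        rewrite Inverse.strictlyInverseˡ ρ t′ | Inverse.strictlyInverseˡ σ j′ = cell

  Iso⇒ColoredIso : ∀ {N N′} → Iso N N′ → ColoredIso M (colour N) (colour N′)
  -- Indiscernibility is applied to the permutation of row codes induced by φ and to φ itself on
  -- columns.
  Iso⇒ColoredIso φ with indiscernible
    (↔-trans (↔-sym Row↔ℕ) (↔-trans (Row-perm (Iso.bijection φ)) Row↔ℕ)) (Iso.bijection φ)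
  ... | τ , image⁰ , image¹ = cell-perm⇒ColoredIso τ ρ (Iso.bijection φ) to from (entry-Iso φ)
    where
    ρ = Row-perm (Iso.bijection φ)

    image⁰-encode : ∀ t → Image ⟦ τ ⟧ (D⁰ (encode t)) ≐ D⁰ (encode (Inverse.to ρ t))
    image⁰-encode t = subst (λ u → Image ⟦ τ ⟧ (D⁰ (encode t)) ≐ D⁰ (encode (Inverse.to ρ u)))
      (Inverse.strictlyInverseʳ Row↔ℕ t) (image⁰ (encode t))

    to : ∀ {c t j} → Cell c t j → Cell (⟦ τ ⟧ c) (Inverse.to ρ t) (⟦ φ ⟧ j)
    to {t = t} {j} ((a , a∈ , ca) , (b , b∈ , cb)) =
      (⟦ τ ⟧ a , proj₁ (image⁰-encode t) (a , a∈ , refl) , Equivalence.to (E₀-inv τ _ _) ca) ,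
      (⟦ τ ⟧ b , proj₁ (image¹ j) (b , b∈ , refl) , Equivalence.to (E₁-inv τ _ _) cb)

    from : ∀ {c t j} → Cell (⟦ τ ⟧ c) (Inverse.to ρ t) (⟦ φ ⟧ j) → Cell c t j
    from {t = t} {j} ((a′ , a′∈ , ca) , (b′ , b′∈ , cb))
      with proj₂ (image⁰-encode t) a′∈ | proj₂ (image¹ j) b′∈
    ... | a , a∈ , refl | b , b∈ , refl =
      (a , a∈ , Equivalence.from (E₀-inv τ _ _) ca) ,
      (b , b∈ , Equivalence.from (E₁-inv τ _ _) cb)

  -- From isomorphisms of colourings to isomorphisms of structures

  crossing-Cell : ∀ {t j a b} → a ∈ D⁰ (encode t) → b ∈ D¹ j →
    ∃[ c ] E₀ c a × E₁ c b × Cell c t j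
  crossing-Cell {a = a} {b} a∈ b∈ =
    let c , ca , cb = crossing (_ , a∈) (_ , b∈) in
    c , ca , cb , (a , a∈ , ca) , (b , b∈ , cb)

  Cell-inhabited : ∀ t j → ∃[ c ] Cell c t j
  Cell-inhabited t j =
    let c , _ , _ , cell = crossing-Cell (proj₂ (D⁰-nonempty (encode t))) (proj₂ (D¹-nonempty j))
    in c , cell

  ColoredIso⇒Iso : ∀ {N N′} → ColoredIso M (colour N) (colour N′) → Iso N N′
  ColoredIso⇒Iso {N} {N′} (τ , preserves) = matching⇒Iso _~ᵣ_ _~ᶜ_ entries
    -- Any cell of a row relates that row, so column 0 is arbitrary, as is the row `(0 , [])` used
    -- for columns.
    (λ t → let c , cell = Cell-inhabited t 0 ; t′ , _ , cell′ = image cell in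
           t′ , proj₁ (related cell cell′))
    (λ t′ → let c , t , _ , cell , cell′ = coimage t′ 0 in t , proj₁ (related cell cell′))
    (λ j → let c , cell = Cell-inhabited (0 , []) j ; _ , j′ , cell′ = image cell in
           j′ , proj₂ (related cell cell′))
    (λ j′ → let c , _ , j , cell , cell′ = coimage (0 , []) j′ in j , proj₂ (related cell cell′))
    where
    _~ᵣ_ : Row → Row → Set
    t ~ᵣ t′ = ∃[ a ] ∃[ a′ ] a ∈ D⁰ (encode t) × a′ ∈ D⁰ (encode t′) × E₀ (⟦ τ ⟧ a) a′

    _~ᶜ_ : ℕ → ℕ → Set
    j ~ᶜ j′ = ∃[ b ] ∃[ b′ ] b ∈ D¹ j × b′ ∈ D¹ j′ × E₁ (⟦ τ ⟧ b) b′

    -- The row and column relations have unrelated witnesses. Crossing yields one c in the cell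
    -- `(t , j)` equivalent to both a and b, and invariance puts its image in the cell `(t′ , j′)`.
    entries : ∀ {t t′ j j′} → t ~ᵣ t′ → j ~ᶜ j′ → entry N′ t′ j′ ≡ entry N t j
    entries (a , a′ , a∈ , a′∈ , aa′) (b , b′ , b∈ , b′∈ , bb′) =
      let c , ca , cb , cell = crossing-Cell a∈ b∈
          cell′ = (a′ , a′∈ , E₀.trans (Equivalence.to (E₀-inv τ _ _) ca) aa′)
                , (b′ , b′∈ , E₁.trans (Equivalence.to (E₁-inv τ _ _) cb) bb′)
      in suc-injective (trans (sym (colour-Cell N′ cell′)) (trans (preserves c) (colour-Cell N cell)))

    image : ∀ {c t j} → Cell c t j → InCell (⟦ τ ⟧ c)
    image {c} cell = colour-suc⇒InCell N′ (trans (preserves c) (colour-Cell N cell))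

    -- Pulling back an element of the target cell along τ keeps its colour non-zero, so the preimage
    -- lies in a cell.
    coimage : ∀ t′ j′ → ∃[ c ] ∃[ t ] ∃[ j ] Cell c t j × Cell (⟦ τ ⟧ c) t′ j′
    coimage t′ j′ =
      let c′ , cell′ = Cell-inhabited t′ j′
          open Inverse (Iso.bijection τ) using (from; strictlyInverseˡ)
          cell″ = subst (λ d → Cell d t′ j′) (sym (strictlyInverseˡ c′)) cell′
          t , j , cell = colour-suc⇒InCell N
            (trans (sym (preserves (from c′))) (colour-Cell N′ cell″))
      in from c′ , t , j , cell , cell″

    related : ∀ {c t t′ j j′} → Cell c t j → Cell (⟦ τ ⟧ c) t′ j′ → t ~ᵣ t′ × j ~ᶜ j′
    related ((a , a∈ , ca) , (b , b∈ , cb)) ((a′ , a′∈ , ca′) , (b′ , b′∈ , cb′)) =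
      (a , a′ , a∈ , a′∈ , E₀.trans (E₀.sym (Equivalence.to (E₀-inv τ _ _) ca)) ca′) ,
      (b , b′ , b∈ , b′∈ , E₁.trans (E₁.sym (Equivalence.to (E₁-inv τ _ _) cb)) cb′)

theorem2p13 : ExcludedMiddle 0ℓ →
    (L : Language) → CountableLanguage L →
    (A : Set) → Countable A →
    (M : Structure L A) → CrossCutting M →
    BorelComplete M
theorem2p13 em L _ A A-countable M X L′ L′-countable Ψ =
  colour ∘ proj₁ , colour-Borel A-countable Ψ , λ N N′ → mk⇔ Iso⇒ColoredIso ColoredIso⇒Iso
  where open Coding em X L′-countable
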